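{- Let $f\le 126$ be a nonnegative integer. Then $f$ is an infertility number if and only if $f\equiv 3\pmod 4$, $f\notin\{95,119\}$, and either $f<27$ or $f\not\equiv 3\pmod{12}$.
   Context: A permutation is an ordering, written in one-line notation, of a finite set of positive integers. West's stack-sorting map $s$ is defined recursively: $s$ sends the empty permutation to itself, and if $\pi=LmR$ is a nonempty permutation with largest entry $m$, then $s(\pi)=s(L)\,s(R)\,m$. The fertility of a permutation $\pi$ is $|s^{ -1}(\pi)|$. A fertility number is a nonnegative integer $f$ such that some permutation has fertility $f$; an infertility number is a nonnegative integer that is not a fertility number. -}

module Defs where

open import Data.Nat using (ℕ; suc; _+_; _≤_; _<_)
open import Data.Nat.Properties using (≤-refl; ≤-trans; ≤-total; ≤-pred; <⇒≱; m≤m+n; m≤n+m; +-suc)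
open import Data.Fin using (Fin)
open import Data.List using (List; []; _∷_; _++_; [_]; length)
open import Data.List.Properties using (length-++; ++-conicalʳ; ∷-injective)
open import Data.List.Relation.Unary.All as All using (All; []; _∷_)
open import Data.List.Relation.Unary.All.Properties as All using (++⁻)
open import Data.List.Relation.Unary.Unique.Propositional using (Unique)
open import Data.List.Relation.Binary.Permutation.Propositional using (_↭_; ↭-refl; ↭-reflexive; ↭-trans; ↭-sym; prep; ↭⇒↭ₛ)
open import Data.List.Relation.Binary.Permutation.Propositional.Properties using (++⁺; ++-comm; All-resp-↭)
import Data.List.Relation.Binary.Permutation.Setoid.Properties as ↭ₛ
open import Data.Product using (Σ-syntax; ∃-syntax; _×_; _,_)
open import Data.Sum using (inj₁; inj₂)
open import Data.Empty using (⊥-elim)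
open import Function.Bundles using (_↔_)
open import Relation.Nullary using (¬_)
open import Relation.Binary.PropositionalEquality using (_≡_; refl; sym; trans; cong; cong₂; subst; setoid)

-- The two proof fields are irrelevant, so that two permutations are equal
-- exactly when their one-line notations are.
record Permutation : Set where
  constructor permutation
  field
    word      : List ℕ
    .distinct : Unique word
    .positive : All (0 <_) word

record LargestEntry (w : List ℕ) : Set where
  constructor largest
  field
    L  : List ℕ
    m  : ℕ
    R  : List ℕ
    w≡ : w ≡ L ++ m ∷ R
    L≤ : All (_≤ m) L
    R≤ : All (_≤ m) R

largestEntry : ∀ x w → LargestEntry (x ∷ w)
largestEntry x []      = largest [] x [] refl [] []
largestEntry x (y ∷ w) with largestEntry y w
... | largest L m R w≡ L≤ R≤ with ≤-total x m
... | inj₁ x≤m = largest (x ∷ L) m R (cong (x ∷_) w≡) (x≤m ∷ L≤) R≤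
... | inj₂ m≤x = largest [] x (y ∷ w) refl [] (subst (All (_≤ x)) (sym w≡)
                   (All.++⁺ (All.map ≤m⇒≤x L≤) (m≤x ∷ All.map ≤m⇒≤x R≤)))
  where
  ≤m⇒≤x : ∀ {k} → k ≤ m → k ≤ x
  ≤m⇒≤x k≤m = ≤-trans k≤m m≤x

length-LmR : ∀ {n} {w : List ℕ} L m R → w ≡ L ++ m ∷ R → length w ≤ suc n → length L + length R ≤ n
length-LmR {n} L m R refl le = ≤-pred (subst (_≤ suc n) eq le)
  where
  eq : length (L ++ m ∷ R) ≡ suc (length L + length R)
  eq = trans (length-++ L {m ∷ R}) (+-suc (length L) (length R))

-- The bound n on the length only serves termination; see sortBounded-irrelevant.
sortBounded : ∀ n (w : List ℕ) → .(length w ≤ n) → List ℕ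
sortBounded n       []      _  = []
sortBounded (suc n) (x ∷ w) le with largestEntry x w
... | largest L m R w≡ _ _ =
  sortBounded n L (≤-trans (m≤m+n (length L) (length R)) (length-LmR L m R w≡ le)) ++
  sortBounded n R (≤-trans (m≤n+m (length R) (length L)) (length-LmR L m R w≡ le)) ++ [ m ]

stackSort : List ℕ → List ℕ
stackSort w = sortBounded (length w) w ≤-refl

sortBounded-irrelevant : ∀ n n′ w .(le : length w ≤ n) .(le′ : length w ≤ n′) →
                         sortBounded n w le ≡ sortBounded n′ w le′
sortBounded-irrelevant n       n′       []      _  _   = refl
sortBounded-irrelevant (suc n) (suc n′) (x ∷ w) le le′ with largestEntry x w
... | largest L m R w≡ _ _ =
  cong₂ (λ (u v : List ℕ) → u ++ v ++ [ m ])
    (sortBounded-irrelevant n n′ L _ _) (sortBounded-irrelevant n n′ R _ _)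

largest-unique : ∀ L m R L′ m′ R′ → L ++ m ∷ R ≡ L′ ++ m′ ∷ R′ →
                 All (_< m) L → All (_< m) R → All (_≤ m′) L′ → All (_≤ m′) R′ →
                 L ≡ L′ × m ≡ m′ × R ≡ R′
largest-unique []      m R []        m′ R′ refl _ _ _ _ = refl , refl , refl
largest-unique []      m R (_ ∷ L′)  m′ R′ refl _ R< (m≤m′ ∷ _) _ with ++⁻ L′ R<
... | _ , (m′<m ∷ _) = ⊥-elim (<⇒≱ m′<m m≤m′)
largest-unique (_ ∷ L) m R []        m′ R′ refl (m′<m ∷ _) _ _ R′≤ with ++⁻ L R′≤
... | _ , (m≤m′ ∷ _) = ⊥-elim (<⇒≱ m′<m m≤m′)
largest-unique (_ ∷ L) m R (_ ∷ L′)  m′ R′ eq (_ ∷ L<) R< (_ ∷ L′≤) R′≤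
  with ∷-injective eq
... | refl , eq′ with largest-unique L m R L′ m′ R′ eq′ L< R< L′≤ R′≤
... | refl , refl , refl = refl , refl , refl

-- West's recursion: together with stackSort [] = [] (which holds by
-- computation), this equation determines stackSort on all permutations.
stackSort-LmR : ∀ L m R → All (_< m) L → All (_< m) R →
                stackSort (L ++ m ∷ R) ≡ stackSort L ++ stackSort R ++ [ m ]
stackSort-LmR L m R L< R< = go (L ++ m ∷ R) refl
  where
  go : ∀ w → w ≡ L ++ m ∷ R → stackSort w ≡ stackSort L ++ stackSort R ++ [ m ]
  go []      eq with () ← ++-conicalʳ L (m ∷ R) (sym eq)
  go (x ∷ w) eq with largestEntry x w
  ... | largest L′ m′ R′ w≡ L′≤ R′≤
    with largest-unique L m R L′ m′ R′ (trans (sym eq) w≡) L< R< L′≤ R′≤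
  ... | refl , refl , refl =
    cong₂ (λ (u v : List ℕ) → u ++ v ++ [ m ])
      (sortBounded-irrelevant (length w) (length L) L _ _)
      (sortBounded-irrelevant (length w) (length R) R _ _)

sortBounded-↭ : ∀ n w .(le : length w ≤ n) → sortBounded n w le ↭ w
sortBounded-↭ n       []      _  = ↭-refl
sortBounded-↭ (suc n) (x ∷ w) le with largestEntry x w
... | largest L m R w≡ _ _ =
  ↭-trans (++⁺ (sortBounded-↭ n L _)
               (↭-trans (++-comm _ [ m ]) (prep m (sortBounded-↭ n R _))))
          (↭-reflexive (sym w≡))

stackSort-↭ : ∀ w → stackSort w ↭ w
stackSort-↭ w = sortBounded-↭ (length w) w ≤-refl

s : Permutation → Permutation
s (permutation w u p) = permutation (stackSort w)
  (↭ₛ.Unique-resp-↭ (setoid ℕ) (↭⇒↭ₛ (↭-sym (stackSort-↭ w))) u)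
  (All-resp-↭ (↭-sym (stackSort-↭ w)) p)

s⁻¹ : Permutation → Set
s⁻¹ π = Σ[ σ ∈ Permutation ] s σ ≡ π

HasFertility : Permutation → ℕ → Set
HasFertility π f = Fin f ↔ s⁻¹ π

FertilityNumber : ℕ → Set
FertilityNumber f = ∃[ π ] HasFertility π f

InfertilityNumber : ℕ → Set
InfertilityNumber f = ¬ FertilityNumber f

{-# OPTIONS --safe #-}
module Submission where

-- Read words backwards, and let S r be the series whose n-th coefficient is the fertility of r
-- with n new largest letters added at its end; for the empty word it is the Catalan series.
-- If b is the largest letter of r = B ++ b ∷ A, then S r = (S A - S A 0) / z for empty B and
-- S r = S B (S A - S A 0) otherwise.  Up to a power of z, every S r is therefore obtained from
-- c = Σ catalan (n + 1) zⁿ by multiplying and by deleting lowest terms, and fertilities are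
-- coefficients of such series.  A nonzero coefficient of zᵉ is at least 2ᵉ, so only e ≤ 6 matters
-- below 127, and there, with the coefficient of zⁱ known only up to 2 ^ (7 - e + i), finitely many
-- series remain; they are enumerated.  Conversely the powers of c give the fertilities 2k, and
-- products of their truncations give k (2k + 3) + 4km.

open import Defs
open import Axiom.UniquenessOfIdentityProofs using (module Decidable⇒UIP)
open import Data.Bool using (Bool; true; false; T; _∧_; _∨_; if_then_else_)
open import Data.Bool.ListAction using (all)
open import Data.Bool.Properties using (T-∧; T-∨; T-≡)
open import Data.Empty using (⊥-elim)
open import Data.Fin using (Fin; zero; suc)
open import Data.Fin.Permutation using (↔⇒≡)
open import Data.Fin.Properties using (+↔⊎; *↔×)
open import Data.List using (List; []; _∷_; _++_; _∷ʳ_; [_]; length; reverse; map; upTo; foldr)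
open import Data.List.Membership.Propositional using (_∈_)
open import Data.List.Membership.Propositional.Properties using (∈-++⁺ˡ; ∈-++⁺ʳ; ∈-upTo⁺)
open import Data.List.Properties
  using (++-assoc; ++-identityʳ; length-++; ∷ʳ-injective; ++-conicalʳ; reverse-++; reverse-involutive;
         reverse-injective; unfold-reverse; ≡-dec)
open import Data.List.Relation.Binary.Permutation.Propositional using (_↭_; ↭-sym; ↭⇒↭ₛ)
open import Data.List.Relation.Binary.Permutation.Propositional.Properties using (All-resp-↭; ↭-empty-inv; ↭-reverse)
import Data.List.Relation.Binary.Permutation.Setoid.Properties as ↭ₛ
open import Data.List.Relation.Unary.All as All using (All; []; _∷_)
import Data.List.Relation.Unary.All.Properties as All
open import Data.List.Relation.Unary.AllPairs using ([]; _∷_; allPairs?)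
import Data.List.Relation.Unary.AllPairs.Properties as AllPairs
open import Data.List.Relation.Unary.Any using (here; there)
open import Data.List.Relation.Unary.Unique.Propositional using (Unique)
open import Data.Nat
open import Data.Nat.Properties
open import Data.Nat.Solver using (module +-*-Solver)
open import Data.Product using (Σ-syntax; ∃; ∃₂; _×_; _,_; proj₁; proj₂; map₁)
open import Data.Product.Function.NonDependent.Propositional using (_×-↔_)
open import Data.Sum using (_⊎_; inj₁; inj₂; [_,_]′)
open import Data.Sum.Function.Propositional using (_⊎-↔_)
open import Data.Unit using (⊤; tt)
open import Function using (_∘_; id)
open import Function.Bundles using (_⇔_; _↔_; mk⇔; mk↔ₛ′; mk⤖; Equivalence)
open import Function.Properties.Bijection using (⤖⇒↔)
open import Function.Properties.Inverse using (↔-sym; ↔-trans)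
open import Relation.Binary.Definitions using (tri<; tri≈; tri>)
open import Relation.Binary.PropositionalEquality
  using (_≡_; _≢_; refl; sym; trans; cong; cong₂; subst; setoid; module ≡-Reasoning)
open import Relation.Nullary using (¬_; Dec; yes; no; ¬?; does; recompute)
open import Relation.Nullary.Decidable using (_×-dec_; _⊎-dec_; _→-dec_; toWitness)
open ≡-Reasoning
open +-*-Solver using (solve; _:=_; _:+_; _:*_; con)

-- Power series over the naturals, Cauchy products and Catalan numbers.

Series : Set
Series = ℕ → ℕ

infixl 7 _⊛_

_⊛_ : Series → Series → Series
(f ⊛ g) zero    = f 0 * g 0
(f ⊛ g) (suc n) = f 0 * g (suc n) + ((f ∘ suc) ⊛ g) n

shift : Series → Series
shift f zero    = 0
shift f (suc n) = f n

-- A coefficient of a product is a sum of terms `f i * g j`, so an additive relation passes from the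
-- terms to the coefficients. It serves for equality, for size bounds (with the second argument
-- ignored) and for agreement up to a cap.
⊛-zip : (P : ℕ → ℕ → Set) → (∀ {a a′ b b′} → P a a′ → P b b′ → P (a + b) (a′ + b′)) →
        ∀ {f g f′ g′} n → (∀ i j → i + j ≡ n → P (f i * g j) (f′ i * g′ j)) →
        P ((f ⊛ g) n) ((f′ ⊛ g′) n)
⊛-zip P P-+ zero    h = h 0 0 refl
⊛-zip P P-+ (suc n) h = P-+ (h 0 (suc n) refl) (⊛-zip P P-+ n λ i j eq → h (suc i) j (cong suc eq))

⊛-cong : ∀ {f g f′ g′} n → (∀ i → i ≤ n → f i ≡ f′ i) → (∀ i → i ≤ n → g i ≡ g′ i) →
         (f ⊛ g) n ≡ (f′ ⊛ g′) n
⊛-cong n f≡ g≡ = ⊛-zip _≡_ (cong₂ _+_) n λ i j eq →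
  cong₂ _*_ (f≡ i (m+n≤o⇒m≤o i (≤-reflexive eq))) (g≡ j (m+n≤o⇒n≤o i (≤-reflexive eq)))

⊛-congʳ : ∀ f {g g′} n → (∀ i → g i ≡ g′ i) → (f ⊛ g) n ≡ (f ⊛ g′) n
⊛-congʳ f n g≡ = ⊛-cong n (λ _ _ → refl) (λ i _ → g≡ i)

⊛-sucʳ : ∀ f g n → (f ⊛ g) (suc n) ≡ (f ⊛ (g ∘ suc)) n + f (suc n) * g 0
⊛-sucʳ f g zero    = refl
⊛-sucʳ f g (suc n) =
  trans (cong (f 0 * g (2 + n) +_) (⊛-sucʳ (f ∘ suc) g n)) (sym (+-assoc (f 0 * g (2 + n)) _ _))

⊛-comm : ∀ f g n → (f ⊛ g) n ≡ (g ⊛ f) n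
⊛-comm f g zero    = *-comm (f 0) (g 0)
⊛-comm f g (suc n) = begin
  f 0 * g (suc n) + ((f ∘ suc) ⊛ g) n  ≡⟨ cong₂ _+_ (*-comm (f 0) _) (⊛-comm (f ∘ suc) g n) ⟩
  g (suc n) * f 0 + (g ⊛ (f ∘ suc)) n  ≡⟨ +-comm (g (suc n) * f 0) _ ⟩
  (g ⊛ (f ∘ suc)) n + g (suc n) * f 0  ≡⟨ ⊛-sucʳ g f n ⟨
  (g ⊛ f) (suc n)                      ∎

⊛-distribˡ : ∀ f g h n → (f ⊛ (λ i → g i + h i)) n ≡ (f ⊛ g) n + (f ⊛ h) n
⊛-distribˡ f g h zero    = *-distribˡ-+ (f 0) (g 0) (h 0)
⊛-distribˡ f g h (suc n) = trans (cong (f 0 * (g (suc n) + h (suc n)) +_) (⊛-distribˡ (f ∘ suc) g h n))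
  (solve 5 (λ a b c x y → a :* (b :+ c) :+ (x :+ y) := a :* b :+ x :+ (a :* c :+ y)) refl
    (f 0) (g (suc n)) (h (suc n)) (((f ∘ suc) ⊛ g) n) (((f ∘ suc) ⊛ h) n))

⊛-scale : ∀ f g a n → (f ⊛ (λ i → g i * a)) n ≡ (f ⊛ g) n * a
⊛-scale f g a zero    = sym (*-assoc (f 0) (g 0) a)
⊛-scale f g a (suc n) = trans (cong (f 0 * (g (suc n) * a) +_) (⊛-scale (f ∘ suc) g a n))
  (solve 4 (λ x y a z → x :* (y :* a) :+ z :* a := (x :* y :+ z) :* a) refl
    (f 0) (g (suc n)) a (((f ∘ suc) ⊛ g) n))

-- Splitting off the constant term of `h` leaves one term of the same shape at a smaller index and
-- one that involves only `f ⊛ g`. Left commutativity thus reduces to commutativity by induction on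
-- `n`.
⊛-assoc-suc : ∀ f g h n → (f ⊛ (g ⊛ h)) (suc n) ≡ (f ⊛ (g ⊛ (h ∘ suc))) n + (f ⊛ g) (suc n) * h 0
⊛-assoc-suc f g h n = begin
  (f ⊛ (g ⊛ h)) (suc n)
    ≡⟨ ⊛-sucʳ f (g ⊛ h) n ⟩
  (f ⊛ ((g ⊛ h) ∘ suc)) n + f (suc n) * (g 0 * h 0)
    ≡⟨ cong (_+ f (suc n) * (g 0 * h 0)) (⊛-congʳ f n (⊛-sucʳ g h)) ⟩
  (f ⊛ (λ i → (g ⊛ (h ∘ suc)) i + g (suc i) * h 0)) n + f (suc n) * (g 0 * h 0)
    ≡⟨ cong (_+ f (suc n) * (g 0 * h 0)) (⊛-distribˡ f _ _ n) ⟩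
  (f ⊛ (g ⊛ (h ∘ suc))) n + (f ⊛ (λ i → g (suc i) * h 0)) n + f (suc n) * (g 0 * h 0)
    ≡⟨ cong (λ x → (f ⊛ (g ⊛ (h ∘ suc))) n + x + f (suc n) * (g 0 * h 0)) (⊛-scale f (g ∘ suc) (h 0) n) ⟩
  (f ⊛ (g ⊛ (h ∘ suc))) n + (f ⊛ (g ∘ suc)) n * h 0 + f (suc n) * (g 0 * h 0)
    ≡⟨ solve 5 (λ x y a b c → x :+ y :* c :+ a :* (b :* c) := x :+ (y :+ a :* b) :* c) refl
         ((f ⊛ (g ⊛ (h ∘ suc))) n) ((f ⊛ (g ∘ suc)) n) (f (suc n)) (g 0) (h 0) ⟩
  (f ⊛ (g ⊛ (h ∘ suc))) n + ((f ⊛ (g ∘ suc)) n + f (suc n) * g 0) * h 0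
    ≡⟨ cong (λ x → (f ⊛ (g ⊛ (h ∘ suc))) n + x * h 0) (⊛-sucʳ f g n) ⟨
  (f ⊛ (g ⊛ (h ∘ suc))) n + (f ⊛ g) (suc n) * h 0 ∎

⊛-leftComm : ∀ f g h n → (f ⊛ (g ⊛ h)) n ≡ (g ⊛ (f ⊛ h)) n
⊛-leftComm f g h zero    = solve 3 (λ a b c → a :* (b :* c) := b :* (a :* c)) refl (f 0) (g 0) (h 0)
⊛-leftComm f g h (suc n) = begin
  (f ⊛ (g ⊛ h)) (suc n)
    ≡⟨ ⊛-assoc-suc f g h n ⟩
  (f ⊛ (g ⊛ (h ∘ suc))) n + (f ⊛ g) (suc n) * h 0
    ≡⟨ cong₂ (λ x y → x + y * h 0) (⊛-leftComm f g (h ∘ suc) n) (⊛-comm f g (suc n)) ⟩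
  (g ⊛ (f ⊛ (h ∘ suc))) n + (g ⊛ f) (suc n) * h 0
    ≡⟨ ⊛-assoc-suc g f h n ⟨
  (g ⊛ (f ⊛ h)) (suc n) ∎

shift-⊛ : ∀ f g n → (shift f ⊛ g) n ≡ shift (f ⊛ g) n
shift-⊛ f g zero    = refl
shift-⊛ f g (suc n) = refl

-- The first argument is fuel for structural recursion. With fuel `zero` the value 1 is a default,
-- correct at n = 0; the fuel suffices whenever n ≤ k.
catalanUpTo : ℕ → Series
catalanUpTo zero    n       = 1
catalanUpTo (suc k) zero    = 1
catalanUpTo (suc k) (suc n) = (catalanUpTo k ⊛ catalanUpTo k) n

catalan : Series
catalan n = catalanUpTo n n

catalanUpTo-stable : ∀ k k′ n → n ≤ k → n ≤ k′ → catalanUpTo k n ≡ catalanUpTo k′ n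
catalanUpTo-stable zero    zero     zero    _ _ = refl
catalanUpTo-stable zero    (suc k′) zero    _ _ = refl
catalanUpTo-stable (suc k) zero     zero    _ _ = refl
catalanUpTo-stable (suc k) (suc k′) zero    _ _ = refl
catalanUpTo-stable (suc k) (suc k′) (suc n) (s≤s n≤k) (s≤s n≤k′) = ⊛-cong n stable stable
  where
  stable : ∀ i → i ≤ n → catalanUpTo k i ≡ catalanUpTo k′ i
  stable i i≤n = catalanUpTo-stable k k′ i (≤-trans i≤n n≤k) (≤-trans i≤n n≤k′)

catalan-suc : ∀ n → catalan (suc n) ≡ (catalan ⊛ catalan) n
catalan-suc n = ⊛-cong n stable stable
  where
  stable : ∀ i → i ≤ n → catalanUpTo n i ≡ catalan i
  stable i i≤n = catalanUpTo-stable n i i i≤n ≤-refl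

-- Sums over the splits of a word into two parts.

sumSplits : (List ℕ → ℕ) → (List ℕ → ℕ) → List ℕ → ℕ
sumSplits f g []      = f [] * g []
sumSplits f g (x ∷ r) = f [] * g (x ∷ r) + sumSplits (f ∘ (x ∷_)) g r

sumSplits⁺ : (List ℕ → ℕ) → (List ℕ → ℕ) → List ℕ → ℕ
sumSplits⁺ f g []      = 0
sumSplits⁺ f g (x ∷ r) = sumSplits (f ∘ (x ∷_)) g r

sumSplits-unfold : ∀ f g r → sumSplits f g r ≡ f [] * g r + sumSplits⁺ f g r
sumSplits-unfold f g []      = sym (+-identityʳ _)
sumSplits-unfold f g (x ∷ r) = refl

sumSplits-cong : ∀ {f f′} g r → (∀ v u → v ++ u ≡ r → f v ≡ f′ v) →
                 sumSplits f g r ≡ sumSplits f′ g r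
sumSplits-cong g []      f≡ = cong (_* g []) (f≡ [] [] refl)
sumSplits-cong g (x ∷ r) f≡ = cong₂ _+_ (cong (_* g (x ∷ r)) (f≡ [] (x ∷ r) refl))
  (sumSplits-cong g r λ v u eq → f≡ (x ∷ v) u (cong (x ∷_) eq))

-- In the intended use `t` starts with a letter larger than all of `B`. A cut before the end of `B`
-- then leaves a second part with letters in front of its largest one, and such a part has fertility
-- 0.
sumSplits-++ : ∀ f g B t → (∀ v y u → v ++ y ∷ u ≡ B → g (y ∷ u ++ t) ≡ 0) →
               sumSplits f g (B ++ t) ≡ sumSplits (f ∘ (B ++_)) g t
sumSplits-++ f g []      t g≡0 = refl
sumSplits-++ f g (x ∷ B) t g≡0 = begin
  f [] * g (x ∷ B ++ t) + sumSplits (f ∘ (x ∷_)) g (B ++ t)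
    ≡⟨ cong (λ a → f [] * a + sumSplits (f ∘ (x ∷_)) g (B ++ t)) (g≡0 [] x B refl) ⟩
  f [] * 0 + sumSplits (f ∘ (x ∷_)) g (B ++ t)
    ≡⟨ cong (_+ sumSplits (f ∘ (x ∷_)) g (B ++ t)) (*-zeroʳ (f [])) ⟩
  sumSplits (f ∘ (x ∷_)) g (B ++ t)
    ≡⟨ sumSplits-++ (f ∘ (x ∷_)) g B t (λ v y u eq → g≡0 (x ∷ v) y u (cong (x ∷_) eq)) ⟩
  sumSplits (f ∘ (x ∷_) ∘ (B ++_)) g t ∎

⊛-sumSplits : ∀ h (F : List ℕ → Series) g r n →
              (h ⊛ (λ i → sumSplits (λ v → F v i) g r)) n ≡ sumSplits (λ v → (h ⊛ F v) n) g r
⊛-sumSplits h F g []      n = ⊛-scale h (F []) (g []) n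
⊛-sumSplits h F g (x ∷ r) n = trans (⊛-distribˡ h _ _ n)
  (cong₂ _+_ (⊛-scale h (F []) (g (x ∷ r)) n) (⊛-sumSplits h (F ∘ (x ∷_)) g r n))

-- Decreasing binary trees and the series of a word.

data Tree : Set where
  leaf : Tree
  node : Tree → ℕ → Tree → Tree

-- Prepending a letter changes the decreasing binary tree only along its leftmost path, so `tree` is
-- structurally recursive. The decomposition at the largest letter is recovered in `tree-node`.
insert : ℕ → Tree → Tree
insert x leaf         = node leaf x leaf
insert x (node B b A) with b ≤? x
... | yes _ = node leaf x (node B b A)
... | no  _ = node (insert x B) b A

tree : List ℕ → Tree
tree []      = leaf
tree (x ∷ r) = insert x (tree r)

-- The factor z of S A - S A 0 is moved onto S B. This avoids subtraction and makes the constant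
-- term 0 by computation when letters precede the largest one.
series : Tree → Series
series leaf                     = catalan
series (node leaf _ A)          = series A ∘ suc
series (node B@(node _ _ _) _ A) = shift (series B) ⊛ (series A ∘ suc)

S : List ℕ → Series
S r = series (tree r)

RootBelow : ℕ → Tree → Set
RootBelow b leaf         = ⊤
RootBelow b (node _ x _) = x ≤ b

insert-RootBelow : ∀ {b x} t → x ≤ b → RootBelow b t → RootBelow b (insert x t)
insert-RootBelow         leaf         x≤b _   = x≤b
insert-RootBelow {x = x} (node B y A) x≤b y≤b with y ≤? x
... | yes _ = x≤b
... | no  _ = y≤b

tree-RootBelow : ∀ {b r} → All (_≤ b) r → RootBelow b (tree r)
tree-RootBelow             []          = tt
tree-RootBelow {r = _ ∷ r} (x≤b ∷ r≤b) = insert-RootBelow (tree r) x≤b (tree-RootBelow r≤b)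

insert-root : ∀ {b} t → RootBelow b t → insert b t ≡ node leaf b t
insert-root     leaf         _   = refl
insert-root {b} (node B x A) x≤b with x ≤? b
... | yes _   = refl
... | no  x≰b = ⊥-elim (x≰b x≤b)

tree-node : ∀ {B b A} → All (_< b) B → All (_< b) A → tree (B ++ b ∷ A) ≡ node (tree B) b (tree A)
tree-node {[]}            []          A<b = insert-root _ (tree-RootBelow (All.map <⇒≤ A<b))
tree-node {x ∷ B} {b} (x<b ∷ B<b) A<b rewrite tree-node B<b A<b with b ≤? x
... | yes b≤x = ⊥-elim (<⇒≱ x<b b≤x)
... | no  _   = refl

S-top : ∀ {b A} → All (_< b) A → S (b ∷ A) ≡ S A ∘ suc
S-top A<b = cong series (tree-node [] A<b)

S-node : ∀ {x B b A} → All (_< b) (x ∷ B) → All (_< b) A →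
         S (x ∷ B ++ b ∷ A) ≡ shift (S (x ∷ B)) ⊛ (S A ∘ suc)
S-node {x} {B} {b} {A} B<b A<b = trans (cong series (tree-node B<b A<b)) (aux (tree B))
  where
  -- `series` distinguishes an empty left subtree, so it has to be seen that an insertion never
  -- yields `leaf`.
  aux : ∀ t → series (node (insert x t) b (tree A)) ≡ shift (series (insert x t)) ⊛ (S A ∘ suc)
  aux leaf         = refl
  aux (node _ y _) with y ≤? x
  ... | yes _ = refl
  ... | no  _ = refl

S-node-zero : ∀ {x B b A} → All (_< b) (x ∷ B) → All (_< b) A → S (x ∷ B ++ b ∷ A) 0 ≡ 0
S-node-zero B<b A<b = cong (λ f → f 0) (S-node B<b A<b)

-- Provides induction on the decomposition at the largest letter, which the left-to-right structure
-- of lists hides.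
data Decreasing : List ℕ → Set where
  []   : Decreasing []
  node : ∀ {B b A} → Decreasing B → Decreasing A → All (_< b) B → All (_< b) A → Decreasing (B ++ b ∷ A)

decreasing-∷ : ∀ {x r} → All (x ≢_) r → Decreasing r → Decreasing (x ∷ r)
decreasing-∷     _ []                             = node [] [] [] []
decreasing-∷ {x} x∉r d@(node {B} {b} dB dA B<b A<b) with All.++⁻ B x∉r
... | x∉B , (x≢b ∷ _) with <-cmp x b
... | tri< x<b _ _ = node (decreasing-∷ x∉B dB) dA (x<b ∷ B<b) A<b
... | tri≈ _ x≡b _ = ⊥-elim (x≢b x≡b)
... | tri> _ _ b<x = node [] d [] (All.++⁺ (All.map (λ <b → <-trans <b b<x) B<b)
                                   (b<x ∷ All.map (λ <b → <-trans <b b<x) A<b))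

decreasing : ∀ {r} → Unique r → Decreasing r
decreasing []          = []
decreasing (x∉r ∷ r!) = decreasing-∷ x∉r (decreasing r!)

-- The last of the n + 1 added letters is the largest; the rest is split either before or among
-- the n others (first term) or inside r.
SplitEquation : List ℕ → Set
SplitEquation r = ∀ n → S r (suc n) ≡ (catalan ⊛ S r) n + sumSplits⁺ (λ v → S v n) (λ u → S u 0) r

-- This is the equation for `A` at `suc n`, with `b` counted as the first added letter. The last
-- term `catalan (suc n) * S A 0` of the convolution turns into the split just after `b`.
splitEquation-top : ∀ {b A} → All (_< b) A → SplitEquation A → SplitEquation (b ∷ A)
splitEquation-top {b} {A} A<b eqA n = begin
  S (b ∷ A) (suc n)
    ≡⟨ cong (λ f → f (suc n)) (S-top A<b) ⟩
  S A (2 + n)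
    ≡⟨ eqA (suc n) ⟩
  (catalan ⊛ S A) (suc n) + sumSplits⁺ (λ v → S v (suc n)) S₀ A
    ≡⟨ cong (_+ sumSplits⁺ (λ v → S v (suc n)) S₀ A) (⊛-sucʳ catalan (S A) n) ⟩
  (catalan ⊛ (S A ∘ suc)) n + catalan (suc n) * S₀ A + sumSplits⁺ (λ v → S v (suc n)) S₀ A
    ≡⟨ +-assoc ((catalan ⊛ (S A ∘ suc)) n) _ _ ⟩
  (catalan ⊛ (S A ∘ suc)) n + (catalan (suc n) * S₀ A + sumSplits⁺ (λ v → S v (suc n)) S₀ A)
    ≡⟨ cong ((catalan ⊛ (S A ∘ suc)) n +_) (sumSplits-unfold (λ v → S v (suc n)) S₀ A) ⟨
  (catalan ⊛ (S A ∘ suc)) n + sumSplits (λ v → S v (suc n)) S₀ A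
    ≡⟨ cong₂ _+_ (⊛-congʳ catalan n λ i → cong (λ f → f i) (sym (S-top A<b)))
         (sumSplits-cong S₀ A λ { v u refl → cong (λ f → f n) (sym (S-top (All.++⁻ˡ v A<b))) }) ⟩
  (catalan ⊛ S (b ∷ A)) n + sumSplits (λ v → S (b ∷ v) n) S₀ A ∎
  where
  S₀ : List ℕ → ℕ
  S₀ u = S u 0

-- In β ⊛ κ every `κ (suc i)` is expanded by the equation for `b ∷ A`, and `shift β` is then
-- absorbed into the series of longer words. The leftover `β n * κ 0` is the split between `x ∷ B`
-- and `b ∷ A`; splits inside `x ∷ B` contribute 0.
splitEquation-node : ∀ {x B b A} → All (_< b) (x ∷ B) → All (_< b) A → SplitEquation A →
                     SplitEquation (x ∷ B ++ b ∷ A)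
splitEquation-node {x} {B} {b} {A} B<b A<b eqA n = begin
  S (x ∷ B ++ b ∷ A) (suc n)
    ≡⟨ cong (λ f → f (suc n)) (S-node B<b A<b) ⟩
  (β ⊛ κ) n
    ≡⟨ split n ⟩
  (shift β ⊛ (κ ∘ suc)) n + β n * κ 0
    ≡⟨ cong (_+ β n * κ 0) (⊛-congʳ (shift β) n κ-suc) ⟩
  (shift β ⊛ (λ i → (catalan ⊛ κ) i + sumSplits (λ v → S v (suc i)) S₀ A)) n + β n * κ 0
    ≡⟨ cong (_+ β n * κ 0) (⊛-distribˡ (shift β) _ _ n) ⟩
  (shift β ⊛ (catalan ⊛ κ)) n + (shift β ⊛ (λ i → sumSplits (λ v → S v (suc i)) S₀ A)) n + β n * κ 0
    ≡⟨ cong₂ (λ a b → a + b + β n * κ 0) (⊛-leftComm (shift β) catalan κ n)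
         (⊛-sumSplits (shift β) (λ v → S v ∘ suc) S₀ A n) ⟩
  (catalan ⊛ (shift β ⊛ κ)) n + sumSplits (λ v → (shift β ⊛ (S v ∘ suc)) n) S₀ A + β n * κ 0
    ≡⟨ solve 3 (λ a b c → a :+ b :+ c := a :+ (c :+ b)) refl ((catalan ⊛ (shift β ⊛ κ)) n) _ _ ⟩
  (catalan ⊛ (shift β ⊛ κ)) n + (β n * κ 0 + sumSplits (λ v → (shift β ⊛ (S v ∘ suc)) n) S₀ A)
    ≡⟨ cong₂ _+_ (⊛-congʳ catalan n λ i → cong (λ f → f i) (sym (S-node B<b A<b)))
         (cong₂ _+_ (cong₂ _*_ (cong (λ v → S v n) (sym (++-identityʳ (x ∷ B)))) (cong (λ f → f 0) (sym (S-top A<b))))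
           (sumSplits-cong S₀ A λ { v u refl → cong (λ f → f n) (sym (S-node B<b (All.++⁻ˡ v A<b))) })) ⟩
  (catalan ⊛ S (x ∷ B ++ b ∷ A)) n + sumSplits (λ v → S (x ∷ B ++ v) n) S₀ (b ∷ A)
    ≡⟨ cong ((catalan ⊛ S (x ∷ B ++ b ∷ A)) n +_)
         (sumSplits-++ (λ v → S (x ∷ v) n) S₀ B (b ∷ A)
           λ { v y u refl → S-node-zero (All.++⁻ʳ (x ∷ v) B<b) A<b }) ⟨
  (catalan ⊛ S (x ∷ B ++ b ∷ A)) n + sumSplits (λ v → S (x ∷ v) n) S₀ (B ++ b ∷ A) ∎
  where
  S₀ : List ℕ → ℕ
  S₀ u = S u 0
  β κ : Series
  β = S (x ∷ B)
  κ = S A ∘ suc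
  split : ∀ n → (β ⊛ κ) n ≡ (shift β ⊛ (κ ∘ suc)) n + β n * κ 0
  split zero    = refl
  split (suc n) = ⊛-sucʳ β κ n
  κ-suc : ∀ i → κ (suc i) ≡ (catalan ⊛ κ) i + sumSplits (λ v → S v (suc i)) S₀ A
  κ-suc i = begin
    S A (2 + i)
      ≡⟨ cong (λ f → f (suc i)) (S-top A<b) ⟨
    S (b ∷ A) (suc i)
      ≡⟨ splitEquation-top A<b eqA i ⟩
    (catalan ⊛ S (b ∷ A)) i + sumSplits (λ v → S (b ∷ v) i) S₀ A
      ≡⟨ cong₂ _+_ (⊛-congʳ catalan i λ j → cong (λ f → f j) (S-top A<b))
           (sumSplits-cong S₀ A λ { v u refl → cong (λ f → f i) (S-top (All.++⁻ˡ v A<b)) }) ⟩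
    (catalan ⊛ κ) i + sumSplits (λ v → S v (suc i)) S₀ A ∎

splitEquation : ∀ {r} → Decreasing r → SplitEquation r
splitEquation []                               n = trans (catalan-suc n) (sym (+-identityʳ _))
splitEquation (node {[]}    _ dA _   A<b)        = splitEquation-top A<b (splitEquation dA)
splitEquation (node {_ ∷ _} _ dA B<b A<b)        = splitEquation-node B<b A<b (splitEquation dA)

-- Preimages under stack-sorting, counted by the series.

Preimage : List ℕ → Set
Preimage w = Σ[ v ∈ List ℕ ] stackSort v ≡ w

preimage-≡ : ∀ {w} {p q : Preimage w} → proj₁ p ≡ proj₁ q → p ≡ q
preimage-≡ {p = v , e} {.v , e′} refl = cong (v ,_) (Decidable⇒UIP.≡-irrelevant (≡-dec _≟_) e e′)

-- Models West's recursion read backwards: in s(L) s(R) m the part `v` is the reverse of s(R) and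
-- `u` the reverse of s(L).
Split : List ℕ → (List ℕ → Set) → (List ℕ → Set) → Set
Split r A B = Σ[ v ∈ List ℕ ] Σ[ u ∈ List ℕ ] (v ++ u ≡ r) × A v × B u

split-[] : ∀ {A B : List ℕ → Set} → (A [] × B []) ↔ Split [] A B
split-[] = mk↔ₛ′ (λ { (a , b) → [] , [] , refl , a , b }) (λ { ([] , [] , refl , a , b) → a , b })
  (λ { ([] , [] , refl , a , b) → refl }) (λ { (a , b) → refl })

split-∷ : ∀ {x r} {A B : List ℕ → Set} → (A [] × B (x ∷ r) ⊎ Split r (A ∘ (x ∷_)) B) ↔ Split (x ∷ r) A B
split-∷ {x} {r} = mk↔ₛ′
  (λ { (inj₁ (a , b)) → [] , x ∷ r , refl , a , b ; (inj₂ (v , u , refl , a , b)) → x ∷ v , u , refl , a , b })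
  (λ { ([] , _ , refl , a , b) → inj₁ (a , b) ; (_ ∷ v , u , refl , a , b) → inj₂ (v , u , refl , a , b) })
  (λ { ([] , _ , refl , a , b) → refl ; (_ ∷ v , u , refl , a , b) → refl })
  (λ { (inj₁ _) → refl ; (inj₂ (v , u , refl , a , b)) → refl })

sumSplits-↔ : ∀ r {f g} {A B : List ℕ → Set} →
              (∀ v u → v ++ u ≡ r → Fin (f v) ↔ A v) → (∀ v u → v ++ u ≡ r → Fin (g u) ↔ B u) →
              Fin (sumSplits f g r) ↔ Split r A B
sumSplits-↔ []      f↔ g↔ = ↔-trans *↔× (↔-trans (f↔ [] [] refl ×-↔ g↔ [] [] refl) split-[])
sumSplits-↔ (x ∷ r) f↔ g↔ = ↔-trans +↔⊎ (↔-trans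
  (↔-trans *↔× (f↔ [] (x ∷ r) refl ×-↔ g↔ [] (x ∷ r) refl)
    ⊎-↔ sumSplits-↔ r (λ v u eq → f↔ (x ∷ v) u (cong (x ∷_) eq)) (λ v u eq → g↔ (x ∷ v) u (cong (x ∷_) eq)))
  split-∷)

unique-++⁻ˡ : ∀ v {u : List ℕ} → Unique (v ++ u) → Unique v
unique-++⁻ˡ []      _          = []
unique-++⁻ˡ (x ∷ v) (x∉ ∷ v!) = All.++⁻ˡ v x∉ ∷ unique-++⁻ˡ v v!

unique-++⁻ʳ : ∀ v {u : List ℕ} → Unique (v ++ u) → Unique u
unique-++⁻ʳ []      u!       = u!
unique-++⁻ʳ (x ∷ v) (_ ∷ v!) = unique-++⁻ʳ v v!

unique-resp-↭ : ∀ {v w : List ℕ} → v ↭ w → Unique v → Unique w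
unique-resp-↭ p = ↭ₛ.Unique-resp-↭ (setoid ℕ) (↭⇒↭ₛ p)

strictly-largest : ∀ L {m R} → Unique (L ++ m ∷ R) → All (_≤ m) L → All (_≤ m) R →
                   All (_< m) L × All (_< m) R
strictly-largest []      (m∉ ∷ _)  []          R≤ =
  [] , All.map (λ (x≤m , m≢x) → ≤∧≢⇒< x≤m (m≢x ∘ sym)) (All.zip (R≤ , m∉))
strictly-largest (x ∷ L) (x∉ ∷ L!) (x≤m ∷ L≤) R≤ =
  map₁ (≤∧≢⇒< x≤m (All.head (All.++⁻ʳ L x∉)) ∷_) (strictly-largest L L! L≤ R≤)

-- The output of `stackSort` ends with the largest entry of its input, so comparing last letters
-- identifies that entry with `m`. Strictness comes from distinctness, carried from `w ∷ʳ m` back to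
-- `v`.
preimage-LmR : ∀ {w m} → Unique (w ∷ʳ m) → ∀ v → stackSort v ≡ w ∷ʳ m →
               ∃₂ λ L R → All (_< m) L × All (_< m) R × v ≡ L ++ m ∷ R × stackSort L ++ stackSort R ≡ w
preimage-LmR {w} {m} _ [] eq with () ← ++-conicalʳ w [ m ] (sym eq)
preimage-LmR {w} {m} w! (x ∷ v) eq = go (largestEntry x v)
  where
  go : LargestEntry (x ∷ v) →
       ∃₂ λ L R → All (_< m) L × All (_< m) R × x ∷ v ≡ L ++ m ∷ R × stackSort L ++ stackSort R ≡ w
  go (largest L m′ R v≡ L≤ R≤)
    with strictly-largest L
           (subst Unique v≡ (unique-resp-↭ (stackSort-↭ (x ∷ v)) (subst Unique (sym eq) w!))) L≤ R≤
  ... | L< , R< with ∷ʳ-injective (stackSort L ++ stackSort R) w (begin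
    (stackSort L ++ stackSort R) ++ [ m′ ] ≡⟨ ++-assoc (stackSort L) _ _ ⟩
    stackSort L ++ stackSort R ++ [ m′ ]   ≡⟨ stackSort-LmR L m′ R L< R< ⟨
    stackSort (L ++ m′ ∷ R)                ≡⟨ cong stackSort v≡ ⟨
    stackSort (x ∷ v)                      ≡⟨ eq ⟩
    w ∷ʳ m                                 ∎)
  ... | w≡ , refl = L , R , L< , R< , v≡ , w≡

all-stackSort : ∀ {m v w} → stackSort v ≡ reverse w → All (_< m) w → All (_< m) v
all-stackSort {v = v} {w} eq w< = All-resp-↭ (stackSort-↭ v)
  (subst (All _) (sym eq) (All-resp-↭ (↭-sym (↭-reverse w)) w<))

-- A preimage determines L and R by the position of `m`, and sorting these determines the cut of
-- `r`. Conversely any two preimages of the parts can be joined around `m`, since all their letters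
-- are smaller.
split↔preimage : ∀ {m r} → Unique (m ∷ r) → All (_< m) r →
                 Split r (Preimage ∘ reverse) (Preimage ∘ reverse) ↔ Preimage (reverse (m ∷ r))
split↔preimage {m} {r} r! r< = ⤖⇒↔ (mk⤖ {to = to} (injective , surjective))
  where
  Splits : Set
  Splits = Split r (Preimage ∘ reverse) (Preimage ∘ reverse)

  L< : ∀ v u {L} → v ++ u ≡ r → stackSort L ≡ reverse u → All (_< m) L
  L< v u refl L≡ = all-stackSort L≡ (All.++⁻ʳ v r<)

  R< : ∀ v u {R} → v ++ u ≡ r → stackSort R ≡ reverse v → All (_< m) R
  R< v u refl R≡ = all-stackSort R≡ (All.++⁻ˡ v r<)

  to : Splits → Preimage (reverse (m ∷ r))
  to (v , u , vu≡ , (R , R≡) , (L , L≡)) = L ++ m ∷ R , (begin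
    stackSort (L ++ m ∷ R)             ≡⟨ stackSort-LmR L m R (L< v u vu≡ L≡) (R< v u vu≡ R≡) ⟩
    stackSort L ++ stackSort R ++ [ m ] ≡⟨ ++-assoc (stackSort L) _ _ ⟨
    (stackSort L ++ stackSort R) ∷ʳ m  ≡⟨ cong (_∷ʳ m) (cong₂ _++_ L≡ R≡) ⟩
    (reverse u ++ reverse v) ∷ʳ m      ≡⟨ cong (_∷ʳ m) (reverse-++ v u) ⟨
    reverse (v ++ u) ∷ʳ m              ≡⟨ unfold-reverse m (v ++ u) ⟨
    reverse (m ∷ v ++ u)               ≡⟨ cong (λ r → reverse (m ∷ r)) vu≡ ⟩
    reverse (m ∷ r)                    ∎)

  split-≡ : ∀ {v u v′ u′ L R L′ R′} (eq : v ++ u ≡ r) (eq′ : v′ ++ u′ ≡ r) →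
            (R≡ : stackSort R ≡ reverse v) (L≡ : stackSort L ≡ reverse u) →
            (R≡′ : stackSort R′ ≡ reverse v′) (L≡′ : stackSort L′ ≡ reverse u′) →
            L ≡ L′ → R ≡ R′ →
            _≡_ {A = Splits} (v , u , eq , (R , R≡) , (L , L≡)) (v′ , u′ , eq′ , (R′ , R≡′) , (L′ , L≡′))
  split-≡ {v} {u} {v′} {u′} eq eq′ R≡ L≡ R≡′ L≡′ refl refl
    with reverse-injective {x = v} {v′} (trans (sym R≡) R≡′)
       | reverse-injective {x = u} {u′} (trans (sym L≡) L≡′)
  ... | refl | refl = cong₂ (λ e (p : Preimage (reverse v) × Preimage (reverse u)) → v , u , e , p)
    (Decidable⇒UIP.≡-irrelevant (≡-dec _≟_) eq eq′) (cong₂ _,_ (preimage-≡ refl) (preimage-≡ refl))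

  injective : ∀ {s s′} → to s ≡ to s′ → s ≡ s′
  injective {v , u , eq , (R , R≡) , (L , L≡)} {v′ , u′ , eq′ , (R′ , R≡′) , (L′ , L≡′)} to≡ =
    split-≡ eq eq′ R≡ L≡ R≡′ L≡′ (proj₁ LmR≡) (proj₂ (proj₂ LmR≡))
    where
    LmR≡ : L ≡ L′ × m ≡ m × R ≡ R′
    LmR≡ = largest-unique L m R L′ m R′ (cong proj₁ to≡) (L< v u eq L≡) (R< v u eq R≡)
      (All.map <⇒≤ (L< v′ u′ eq′ L≡′)) (All.map <⇒≤ (R< v′ u′ eq′ R≡′))

  rm! : Unique (reverse r ∷ʳ m)
  rm! = subst Unique (unfold-reverse m r) (unique-resp-↭ (↭-sym (↭-reverse (m ∷ r))) r!)

  surjective : ∀ p → ∃ λ s → ∀ {z} → z ≡ s → to z ≡ p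
  surjective (v , v≡) with preimage-LmR rm! v (trans v≡ (unfold-reverse m r))
  ... | L , R , _ , _ , LmR≡ , LR≡ =
    (reverse (stackSort R) , reverse (stackSort L) , splits ,
      (R , sym (reverse-involutive _)) , (L , sym (reverse-involutive _)))
    , λ { refl → preimage-≡ (sym LmR≡) }
    where
    splits : reverse (stackSort R) ++ reverse (stackSort L) ≡ r
    splits = begin
      reverse (stackSort R) ++ reverse (stackSort L) ≡⟨ reverse-++ (stackSort L) (stackSort R) ⟨
      reverse (stackSort L ++ stackSort R)           ≡⟨ cong reverse LR≡ ⟩
      reverse (reverse r)                            ≡⟨ reverse-involutive r ⟩
      r                                              ∎

¬preimage : ∀ {m r} → Unique (m ∷ r) → ¬ All (_< m) r → ¬ Preimage (reverse (m ∷ r))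
¬preimage {m} {r} r! r≮ (v , v≡)
  with preimage-LmR (subst Unique (unfold-reverse m r) (unique-resp-↭ (↭-sym (↭-reverse (m ∷ r))) r!))
         v (trans v≡ (unfold-reverse m r))
... | L , R , L< , R< , _ , LR≡ = r≮ (All-resp-↭ (↭-reverse r) (subst (All (_< m)) LR≡
  (All.++⁺ (All-resp-↭ (↭-sym (stackSort-↭ L)) L<) (All-resp-↭ (↭-sym (stackSort-↭ R)) R<))))

S-zero : ∀ {m r} → Decreasing (m ∷ r) → ¬ All (_< m) r → S (m ∷ r) 0 ≡ 0
S-zero d = aux d refl
  where
  aux : ∀ {m r r′} → Decreasing r′ → r′ ≡ m ∷ r → ¬ All (_< m) r → S r′ 0 ≡ 0
  aux (node {[]}    _ _ _  A<) refl r≮ = ⊥-elim (r≮ A<)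
  aux (node {_ ∷ _} _ _ B< A<) refl _  = S-node-zero B< A<

-- The split equation at n = 0, where `catalan 0 * S r 0` is exactly the split with empty first
-- part.
S-splits : ∀ {m r} → Unique (m ∷ r) → All (_< m) r → S (m ∷ r) 0 ≡ sumSplits (λ v → S v 0) (λ u → S u 0) r
S-splits {m} {r} (_ ∷ r!) r< = begin
  S (m ∷ r) 0
    ≡⟨ cong (λ f → f 0) (S-top r<) ⟩
  S r 1
    ≡⟨ splitEquation (decreasing r!) 0 ⟩
  catalan 0 * S r 0 + sumSplits⁺ (λ v → S v 0) (λ u → S u 0) r
    ≡⟨ sumSplits-unfold (λ v → S v 0) (λ u → S u 0) r ⟨
  sumSplits (λ v → S v 0) (λ u → S u 0) r ∎

preimage-[] : Fin 1 ↔ Preimage []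
preimage-[] = mk↔ₛ′ (λ _ → [] , refl) (λ _ → zero)
  (λ (v , v≡) → preimage-≡ (sym (↭-empty-inv (subst (v ↭_) v≡ (↭-sym (stackSort-↭ v))))))
  (λ { zero → refl ; (suc ()) })

-- Both parts of a split are shorter than the word, so the recursion runs on a length bound. If `m`
-- is not the largest letter, both sides are empty.
preimages : ∀ n r → length r ≤ n → Unique r → Fin (S r 0) ↔ Preimage (reverse r)
preimages n       []      _         _  = preimage-[]
preimages (suc n) (m ∷ r) (s≤s r≤n) r! with All.all? (_<? m) r
... | yes r< = subst (λ k → Fin k ↔ Preimage (reverse (m ∷ r))) (sym (S-splits r! r<))
  (↔-trans (sumSplits-↔ r
      (λ { v u refl → preimages n v
             (≤-trans (≤-trans (m≤m+n _ _) (≤-reflexive (sym (length-++ v)))) r≤n) (unique-++⁻ˡ v (unique-++⁻ʳ [ m ] r!)) })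
      (λ { v u refl → preimages n u
             (≤-trans (≤-trans (m≤n+m _ (length v)) (≤-reflexive (sym (length-++ v)))) r≤n) (unique-++⁻ʳ (m ∷ v) r!) }))
    (split↔preimage r! r<))
... | no  r≮ = subst (λ k → Fin k ↔ Preimage (reverse (m ∷ r))) (sym (S-zero (decreasing r!) r≮))
  (mk↔ₛ′ (λ ()) (⊥-elim ∘ ¬preimage r! r≮) (⊥-elim ∘ ¬preimage r! r≮) (λ ()))

s⁻¹↔preimage : ∀ π → s⁻¹ π ↔ Preimage (Permutation.word π)
s⁻¹↔preimage π@(permutation w w! w⁺) = mk↔ₛ′ (λ (σ , eq) → Permutation.word σ , cong Permutation.word eq) from
  (λ { (v , refl) → refl }) (λ { (σ , refl) → refl })
  where
  from : Preimage w → s⁻¹ π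
  from (v , refl) = permutation v (unique-resp-↭ (stackSort-↭ v) w!) (All-resp-↭ (stackSort-↭ v) w⁺) , refl

fertility : Permutation → ℕ
fertility π = S (reverse (Permutation.word π)) 0

hasFertility : ∀ π → HasFertility π (fertility π)
hasFertility π@(permutation w w! _) = ↔-trans
  (subst (λ w′ → Fin (fertility π) ↔ Preimage w′) (reverse-involutive w)
    (preimages _ (reverse w) ≤-refl (unique-resp-↭ (↭-sym (↭-reverse w))
      -- The proof of distinctness is irrelevant; deciding distinctness recovers a usable one.
      (recompute (allPairs? (λ x y → ¬? (x ≟ y)) w) w!))))
  (↔-sym (s⁻¹↔preimage π))

-- Size bounds and the closure of the Catalan series under products and truncations.

data Size (e : ℕ) : ℕ → Set where
  none : Size e 0
  big  : ∀ {x} → 2 ^ e ≤ x → Size e x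

size-+ : ∀ {e x y} → Size e x → Size e y → Size e (x + y)
size-+     none      s = s
size-+ {y = y} (big b) _ = big (≤-trans b (m≤m+n _ y))

size-* : ∀ {i j x y} → Size i x → Size j y → Size (i + j) (x * y)
size-*         none    _       = none
size-* {x = x} (big b) none    = subst (Size _) (sym (*-zeroʳ x)) none
size-* {i} {j} (big b) (big c) = big (≤-trans (≤-reflexive (^-distribˡ-+-* 2 i j)) (*-mono-≤ b c))

cut : ℕ → Series → Series
cut zero    f         = f
cut (suc i) f zero    = 0
cut (suc i) f (suc n) = cut i (f ∘ suc) n

cut-cong : ∀ i {f g} → (∀ n → f n ≡ g n) → ∀ n → cut i f n ≡ cut i g n
cut-cong zero    f≡g n       = f≡g n
cut-cong (suc i) f≡g zero    = refl
cut-cong (suc i) f≡g (suc n) = cut-cong i (f≡g ∘ suc) n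

data 𝓡 : Series → Set where
  gen : 𝓡 (catalan ∘ suc)
  mul : ∀ {φ ψ} → 𝓡 φ → 𝓡 ψ → 𝓡 (φ ⊛ ψ)
  trunc : ∀ i {φ} → 𝓡 φ → 𝓡 (cut i φ)

-- The two extreme terms of the Catalan convolution are both `catalan (suc e)`, so each step at
-- least doubles.
catalan-size : ∀ e → 2 ^ e ≤ catalan (suc e)
catalan-size zero    = ≤-refl
catalan-size (suc e) = subst (2 ^ suc e ≤_) (sym (catalan-suc (suc e))) (+-mono-≤
  (≤-trans (catalan-size e) (≤-reflexive (sym (*-identityˡ _))))
  (≤-trans (≤-reflexive (+-identityʳ _)) (≤-trans (catalan-size e) (last-≤ (catalan ∘ suc) e))))
  where
  last-≤ : ∀ f e → f e ≤ (f ⊛ catalan) e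
  last-≤ f zero    = ≤-reflexive (sym (*-identityʳ (f 0)))
  last-≤ f (suc e) = ≤-trans (last-≤ (f ∘ suc) e) (m≤n+m _ (f 0 * catalan (suc e)))

cut-size : ∀ i {φ} d → (∀ e → Size (d + e) (φ e)) → ∀ e → Size (d + e) (cut i φ e)
cut-size zero        d h e       = h e
cut-size (suc i)     d h zero    = none
cut-size (suc i) {φ} d h (suc e) = subst (λ k → Size k (cut i (φ ∘ suc) e)) (sym (+-suc d e))
  (cut-size i (suc d) (λ e → subst (λ k → Size k (φ (suc e))) (+-suc d e) (h (suc e))) e)

𝓡-size : ∀ {φ} → 𝓡 φ → ∀ e → Size e (φ e)
𝓡-size gen                   e = big (catalan-size e)
𝓡-size (mul {φ} {ψ} φ∈ ψ∈) e = ⊛-zip (λ x _ → Size e x) size-+ {f′ = φ} {ψ} e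
  λ { i j refl → size-* (𝓡-size φ∈ i) (𝓡-size ψ∈ j) }
𝓡-size (trunc i φ∈)           e = cut-size i 0 (𝓡-size φ∈) e

-- The arithmetic condition and series with capped coefficients.

Infertile : ℕ → Set
Infertile f = f % 4 ≡ 3 × (f ≢ 95 × f ≢ 119) × (f < 27 ⊎ f % 12 ≢ 3)

infertile? : ∀ f → Dec (Infertile f)
infertile? f = (f % 4 ≟ 3) ×-dec (¬? (f ≟ 95) ×-dec ¬? (f ≟ 119)) ×-dec ((f <? 27) ⊎-dec ¬? (f % 12 ≟ 3))

Allowed : ℕ → Set
Allowed f = f ≤ 126 → ¬ Infertile f

allowed? : ∀ f → Dec (Allowed f)
allowed? f = (f ≤? 126) →-dec ¬? (infertile? f)

fromDoes : ∀ {P : Set} (P? : Dec P) → T (does P?) → P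
fromDoes (yes p) _ = p

State : Set
State = List ℕ

-- The cap doubles with the exponent, in step with the least nonzero size in 𝓡; this makes capping
-- compatible with products. `⊓′` evaluates faster than the unary `⊓`.
capped : ℕ → ℕ → Series → State
capped k zero    f = []
capped k (suc n) f = f 0 ⊓′ 2 ^ k ∷ capped (suc k) n (f ∘ suc)

coeff : State → Series
coeff []       _       = 0
coeff (x ∷ xs) zero    = x
coeff (x ∷ xs) (suc n) = coeff xs n

capped-cong : ∀ k n {f g} → (∀ i → i < n → f i ⊓′ 2 ^ (i + k) ≡ g i ⊓′ 2 ^ (i + k)) →
              capped k n f ≡ capped k n g
capped-cong k zero    f≡g = refl
capped-cong k (suc n) {f} {g} f≡g = cong₂ _∷_ (f≡g 0 z<s) (capped-cong (suc k) n λ i i<n →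
  subst (λ e → f (suc i) ⊓′ 2 ^ e ≡ g (suc i) ⊓′ 2 ^ e) (sym (+-suc i k)) (f≡g (suc i) (s<s i<n)))

coeff-capped : ∀ k n f i → i < n → coeff (capped k n f) i ≡ f i ⊓′ 2 ^ (i + k)
coeff-capped k (suc n) f zero    _         = refl
coeff-capped k (suc n) f (suc i) (s≤s i<n) =
  trans (coeff-capped (suc k) n (f ∘ suc) i i<n) (cong (λ e → f (suc i) ⊓′ 2 ^ e) (+-suc i k))

AgreeBelow : ℕ → ℕ → ℕ → Set
AgreeBelow N x y = x ≡ y ⊎ N ≤ x × N ≤ y

agree-⊓′ : ∀ N x → AgreeBelow N x (x ⊓′ N)
agree-⊓′ N x with ≤-total x N
... | inj₁ x≤N = inj₁ (trans (sym (m≤n⇒m⊓n≡m x≤N)) (⊓≡⊓′ x N))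
... | inj₂ N≤x = inj₂ (N≤x , ≤-reflexive (trans (sym (m≥n⇒m⊓n≡n N≤x)) (⊓≡⊓′ x N)))

agree⇒⊓′ : ∀ {N x y} → AgreeBelow N x y → x ⊓′ N ≡ y ⊓′ N
agree⇒⊓′ (inj₁ refl) = refl
agree⇒⊓′ {N} {x} {y} (inj₂ (N≤x , N≤y)) = begin
  x ⊓′ N ≡⟨ ⊓≡⊓′ x N ⟨
  x ⊓ N  ≡⟨ trans (m≥n⇒m⊓n≡n N≤x) (sym (m≥n⇒m⊓n≡n N≤y)) ⟩
  y ⊓ N  ≡⟨ ⊓≡⊓′ y N ⟩
  y ⊓′ N ∎

agree-+ : ∀ {N x y x′ y′} → AgreeBelow N x x′ → AgreeBelow N y y′ → AgreeBelow N (x + y) (x′ + y′)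
agree-+ (inj₁ refl) (inj₁ refl) = inj₁ refl
agree-+ {x = x} {x′ = x′} _ (inj₂ (N≤y , N≤y′)) = inj₂ (≤-trans N≤y (m≤n+m _ x) , ≤-trans N≤y′ (m≤n+m _ x′))
agree-+ {y = y} {y′ = y′} (inj₂ (N≤x , N≤x′)) _ = inj₂ (≤-trans N≤x (m≤m+n _ y) , ≤-trans N≤x′ (m≤m+n _ y′))

size-⊓′ : ∀ {e x} k → Size e x → Size e (x ⊓′ 2 ^ (e + k))
size-⊓′ {e} k none = subst (Size e) (⊓≡⊓′ 0 (2 ^ (e + k))) none
size-⊓′ {e} {x} k (big b) = big (subst (2 ^ e ≤_) (⊓≡⊓′ x (2 ^ (e + k))) (⊓-glb b (^-monoʳ-≤ 2 (m≤m+n e k))))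

-- A factor at its cap 2 ^ (i + k) makes the product either zero on both sides or
-- at least 2 ^ (i + j + k), because a nonzero second factor is at least 2 ^ j.
agree-* : ∀ {i j x x′ y y′} k → Size i x → Size i x′ → Size j y → Size j y′ →
          AgreeBelow (2 ^ (i + k)) x x′ → AgreeBelow (2 ^ (j + k)) y y′ →
          AgreeBelow (2 ^ (i + j + k)) (x * y) (x′ * y′)
agree-* {i} {j} {x} {x′} {y} {y′} k = go
  where
  bound : ∀ a b {x y} → a + b ≡ i + j + k → 2 ^ a ≤ x → 2 ^ b ≤ y → 2 ^ (i + j + k) ≤ x * y
  bound a b eq p q = subst (_≤ _) (trans (sym (^-distribˡ-+-* 2 a b)) (cong (2 ^_) eq)) (*-mono-≤ p q)
  boundˡ : ∀ {x y} → 2 ^ (i + k) ≤ x → 2 ^ j ≤ y → 2 ^ (i + j + k) ≤ x * y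
  boundˡ = bound (i + k) j (trans (+-assoc i k j) (trans (cong (i +_) (+-comm k j)) (sym (+-assoc i j k))))
  boundʳ : ∀ {x y} → 2 ^ i ≤ x → 2 ^ (j + k) ≤ y → 2 ^ (i + j + k) ≤ x * y
  boundʳ = bound i (j + k) (sym (+-assoc i j k))
  grow : ∀ e → 2 ^ e ≤ 2 ^ (e + k)
  grow e = ^-monoʳ-≤ 2 (m≤m+n e k)
  go : Size i x → Size i x′ → Size j y → Size j y′ →
       AgreeBelow (2 ^ (i + k)) x x′ → AgreeBelow (2 ^ (j + k)) y y′ →
       AgreeBelow (2 ^ (i + j + k)) (x * y) (x′ * y′)
  go _ _ _ _ (inj₁ refl) (inj₁ refl) = inj₁ refl
  go _ _ none    _ (inj₂ _)       (inj₁ refl) = inj₁ (trans (*-zeroʳ x) (sym (*-zeroʳ x′)))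
  go _ _ (big c) _ (inj₂ (p , q)) (inj₁ refl) = inj₂ (boundˡ p c , boundˡ q c)
  go none    _ _ _ (inj₁ refl) (inj₂ _)       = inj₁ refl
  go (big b) _ _ _ (inj₁ refl) (inj₂ (p , q)) =
    inj₂ (boundʳ b p , boundʳ b q)
  go _ _ _ _ (inj₂ (p , q)) (inj₂ (p′ , q′)) =
    inj₂ (boundˡ p (≤-trans (grow j) p′) , boundˡ q (≤-trans (grow j) q′))

-- Termwise by `agree-*`: replacing coefficients by their capped values keeps the size bounds, since
-- the cap at `e` is at least 2 ^ e. Hence 𝓡 acts on states alone.
capped-⊛ : ∀ k n {f g} → (∀ e → Size e (f e)) → (∀ e → Size e (g e)) →
           capped k n (f ⊛ g) ≡ capped k n (coeff (capped k n f) ⊛ coeff (capped k n g))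
capped-⊛ k n {f} {g} f-size g-size = capped-cong k n λ e e<n → agree⇒⊓′
  (⊛-zip (AgreeBelow (2 ^ (e + k))) agree-+ e λ { i j refl → aux i j e<n })
  where
  aux : ∀ i j → i + j < n → AgreeBelow (2 ^ (i + j + k)) (f i * g j)
          (coeff (capped k n f) i * coeff (capped k n g) j)
  aux i j i+j<n rewrite coeff-capped k n f i (≤-<-trans (m≤m+n i j) i+j<n)
                      | coeff-capped k n g j (≤-<-trans (m≤n+m j i) i+j<n) =
    agree-* k (f-size i) (size-⊓′ k (f-size i)) (g-size j) (size-⊓′ k (g-size j))
      (agree-⊓′ _ (f i)) (agree-⊓′ _ (g j))

⊓′-idem : ∀ x N → x ⊓′ N ≡ x ⊓′ N ⊓′ N
⊓′-idem x N = agree⇒⊓′ (agree-⊓′ N x)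

cut-< : ∀ i f n → n < i → cut i f n ≡ 0
cut-< (suc i) f zero    _         = refl
cut-< (suc i) f (suc n) (s≤s n<i) = cut-< i (f ∘ suc) n n<i

cut-≥ : ∀ i f n → i ≤ n → cut i f n ≡ f n
cut-≥ zero    f n       _         = refl
cut-≥ (suc i) f (suc n) (s≤s i≤n) = cut-≥ i (f ∘ suc) n i≤n

-- All cuts at `n` or beyond erase every stored coefficient, so finitely many cuts represent all of
-- them.
capped-cut : ∀ k n i f → capped k n (cut i f) ≡ capped k n (cut (i ⊓ n) (coeff (capped k n f)))
capped-cut k n i f = capped-cong k n λ e e<n → cong-⊓′ e e<n (i ≤? e)
  where
  cong-⊓′ : ∀ e → e < n → Dec (i ≤ e) →
            cut i f e ⊓′ 2 ^ (e + k) ≡ cut (i ⊓ n) (coeff (capped k n f)) e ⊓′ 2 ^ (e + k)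
  cong-⊓′ e e<n (yes i≤e)
    rewrite cut-≥ i f e i≤e | cut-≥ (i ⊓ n) (coeff (capped k n f)) e (≤-trans (m⊓n≤m i n) i≤e)
          | coeff-capped k n f e e<n = ⊓′-idem (f e) (2 ^ (e + k))
  cong-⊓′ e e<n (no  i≰e)
    rewrite cut-< i f e (≰⇒> i≰e) | cut-< (i ⊓ n) (coeff (capped k n f)) e (⊓-glb (≰⇒> i≰e) e<n) = refl

-- Enumeration of the reachable states.

_==_ : State → State → Bool
[]       == []       = true
(x ∷ xs) == (y ∷ ys) = (x ≡ᵇ y) ∧ (xs == ys)
_        == _        = false

==-sound : ∀ xs ys → T (xs == ys) → xs ≡ ys
==-sound []       []       _ = refl
==-sound (x ∷ xs) (y ∷ ys) t with Equivalence.to T-∧ t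
... | t₁ , t₂ = cong₂ _∷_ (≡ᵇ⇒≡ x y t₁) (==-sound xs ys t₂)

data SearchTree : Set where
  leaf : SearchTree
  node : SearchTree → ℕ → State → SearchTree → SearchTree

-- The hash only guides the search: membership is confirmed by comparing states.
hash : State → ℕ
hash = foldr (λ a h → (a + h * 389) % 1009) 0

add : ℕ → State → SearchTree → SearchTree
add h x leaf           = node leaf h x leaf
add h x (node l k y r) = if h <ᵇ k then node (add h x l) k y r else node l k y (add h x r)

member : ℕ → State → SearchTree → Bool
member h x leaf           = false
member h x (node l k y r) = if h <ᵇ k then member h x l else (((h ≡ᵇ k) ∧ (x == y)) ∨ member h x r)

_∈ᵇ_ : State → SearchTree → Bool
x ∈ᵇ t = member (hash x) x t

elements : SearchTree → List State
elements leaf           = []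
elements (node l _ x r) = x ∷ elements l ++ elements r


member-sound : ∀ h x t → T (member h x t) → x ∈ elements t
member-sound h x (node l k y r) m with h <ᵇ k
... | true  = there (∈-++⁺ˡ (member-sound h x l m))
... | false with Equivalence.to T-∨ m
...   | inj₁ e = here (==-sound x y (proj₂ (Equivalence.to (T-∧ {h ≡ᵇ k}) e)))
...   | inj₂ m = there (∈-++⁺ʳ (elements l) (member-sound h x r m))

module Capped (k n : ℕ) where
  cutS : State → ℕ → State
  cutS x i = capped k (suc n) (cut i (coeff x))

  mulS : State → State → State
  mulS x y = capped k (suc n) (coeff x ⊛ coeff y)

  -- A worklist search, `X` listing the states already found. Products with `x` itself and with
  -- earlier states suffice because `⊛` is commutative.
  closeUnder : ℕ → List State → List State → SearchTree → SearchTree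
  closeUnder zero       todo       X t = t
  closeUnder (suc fuel) []         X t = t
  closeUnder (suc fuel) (x ∷ todo) X t =
    if x ∈ᵇ t then closeUnder fuel todo X t
    else closeUnder fuel (map (cutS x) (upTo (2 + n)) ++ map (mulS x) (x ∷ X) ++ todo) (x ∷ X) (add (hash x) x t)

  allowedᵇ : State → Bool
  allowedᵇ x = does (allowed? (coeff x n))

  -- Certifies a tree whatever its origin: exhausted fuel or a misled search could only turn the
  -- answer to `false`.
  closedᵇ : SearchTree → Bool
  closedᵇ t = (capped k (suc n) (catalan ∘ suc) ∈ᵇ t) ∧
    all (λ x → allowedᵇ x ∧ all (λ i → cutS x i ∈ᵇ t) (upTo (2 + n)) ∧
               all (λ y → mulS x y ∈ᵇ t) (elements t)) (elements t)

  states : SearchTree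
  states = closeUnder 100000 (capped k (suc n) (catalan ∘ suc) ∷ []) [] leaf

  -- By induction over 𝓡 the state of φ lies in `t`, where the last coefficient of every state has
  -- been checked.
  closed⇒allowed : ∀ t → closedᵇ t ≡ true → n + k ≡ 7 → ∀ {φ} → 𝓡 φ → Allowed (φ n)
  closed⇒allowed t c n+k {φ} φ∈ φn≤126 = subst Allowed φn≡
    (fromDoes (allowed? (coeff (capped k (suc n) φ) n)) (All.lookup (proj₁ closed) (state φ∈))) φn≤126
    where
    sound : ∀ x → T (x ∈ᵇ t) → x ∈ elements t
    sound x = member-sound (hash x) x t
    c′ : T (capped k (suc n) (catalan ∘ suc) ∈ᵇ t) × T (all _ (elements t))
    c′ = Equivalence.to T-∧ (Equivalence.from T-≡ c)
    closed : All (λ x → T (allowedᵇ x)) (elements t) ×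
             All (λ x → ∀ i → i < 2 + n → cutS x i ∈ elements t) (elements t) ×
             All (λ x → ∀ y → y ∈ elements t → mulS x y ∈ elements t) (elements t)
    closed = All.map proj₁ cl , All.map (proj₁ ∘ proj₂) cl , All.map (proj₂ ∘ proj₂) cl
      where
      cl : All (λ x → T (allowedᵇ x) × (∀ i → i < 2 + n → cutS x i ∈ elements t) ×
                      (∀ y → y ∈ elements t → mulS x y ∈ elements t)) (elements t)
      cl = All.map (λ {x} c → let a , c′ = Equivalence.to (T-∧ {allowedᵇ x}) c
                                  d , e  = Equivalence.to T-∧ c′
                              in a , (λ i i< → sound _ (All.lookup (All.all⁺ (λ i → cutS x i ∈ᵇ t) _ d) (∈-upTo⁺ i<))) ,
                                 λ y y∈ → sound _ (All.lookup (All.all⁺ (λ y → mulS x y ∈ᵇ t) _ e) y∈))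
             (All.all⁺ _ _ (proj₂ c′))
    state : ∀ {φ} → 𝓡 φ → capped k (suc n) φ ∈ elements t
    state gen               = sound _ (proj₁ c′)
    state (mul {φ} φ∈ ψ∈)  = subst (_∈ elements t) (sym (capped-⊛ k (suc n) (𝓡-size φ∈) (𝓡-size ψ∈)))
                                (All.lookup (proj₂ (proj₂ closed)) (state φ∈) _ (state ψ∈))
    state (trunc i {φ} φ∈)    = subst (_∈ elements t) (sym (capped-cut k (suc n) i φ))
                                (All.lookup (proj₁ (proj₂ closed)) (state φ∈) (i ⊓ suc n) (s≤s (m⊓n≤n i (suc n))))
    φn≡ : coeff (capped k (suc n) φ) n ≡ φ n
    -- The cap of the last coefficient is 2 ^ 7 = 128, so a value at most 126 is stored exactly.
    φn≡ rewrite coeff-capped k (suc n) φ n ≤-refl | n+k =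
      trans (sym (⊓≡⊓′ (φ n) 128)) (m≤n⇒m⊓n≡m (≤-trans φn≤126 (m≤n+m 126 2)))

closedAt : ℕ → Bool
closedAt n = Capped.closedᵇ (7 ∸ n) n (Capped.states (7 ∸ n) n)

-- Each `refl` runs the enumeration and its certificate during type checking.
closedAt-< : ∀ n → n < 7 → closedAt n ≡ true
closedAt-< 0 _ = refl
closedAt-< 1 _ = refl
closedAt-< 2 _ = refl
closedAt-< 3 _ = refl
closedAt-< 4 _ = refl
closedAt-< 5 _ = refl
closedAt-< 6 _ = refl
closedAt-< (suc (suc (suc (suc (suc (suc (suc _))))))) (s≤s (s≤s (s≤s (s≤s (s≤s (s≤s (s≤s ())))))))

𝓡-allowed : ∀ {φ} → 𝓡 φ → ∀ e → Allowed (φ e)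
𝓡-allowed {φ} φ∈ e with e <? 7
... | yes e<7 = Capped.closed⇒allowed (7 ∸ e) e (Capped.states (7 ∸ e) e)
                  (closedAt-< e e<7) (m+[n∸m]≡n (<⇒≤ e<7)) φ∈
-- From exponent 7 on, a coefficient is either 0, which is not 3 modulo 4, or at least 128.
... | no  e≮7 with φ e | 𝓡-size φ∈ e
...   | _ | none  = λ { _ (() , _) }
...   | _ | big b = λ φe≤ → ⊥-elim (<⇒≱ (≤-trans (^-monoʳ-≤ 2 (≮⇒≥ e≮7)) b) (≤-trans φe≤ (n≤1+n 126)))

-- Powers of z, and fertilities as coefficients of series in 𝓡.

shift-cong : ∀ {f g} → (∀ n → f n ≡ g n) → ∀ n → shift f n ≡ shift g n
shift-cong f≡g zero    = refl
shift-cong f≡g (suc n) = f≡g n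

⊛-shift : ∀ f g n → (f ⊛ shift g) n ≡ shift (f ⊛ g) n
⊛-shift f g n = begin
  (f ⊛ shift g) n ≡⟨ ⊛-comm f (shift g) n ⟩
  (shift g ⊛ f) n ≡⟨ shift-⊛ g f n ⟩
  shift (g ⊛ f) n ≡⟨ shift-cong (⊛-comm g f) n ⟩
  shift (f ⊛ g) n ∎

shifts : ℕ → Series → Series
shifts zero    f = f
shifts (suc p) f = shift (shifts p f)

shifts-cong : ∀ p {f g} → (∀ n → f n ≡ g n) → ∀ n → shifts p f n ≡ shifts p g n
shifts-cong zero    f≡g = f≡g
shifts-cong (suc p) f≡g = shift-cong (shifts-cong p f≡g)

shifts-shift : ∀ p f n → shifts p (shift f) n ≡ shifts (suc p) f n
shifts-shift zero    f n = refl
shifts-shift (suc p) f n = shift-cong (shifts-shift p f) n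

shifts-⊛ : ∀ p q f g n → (shifts p f ⊛ shifts q g) n ≡ shifts (p + q) (f ⊛ g) n
shifts-⊛ zero    zero    f g n = refl
shifts-⊛ zero    (suc q) f g n = trans (⊛-shift f (shifts q g) n) (shift-cong (shifts-⊛ zero q f g) n)
shifts-⊛ (suc p) q       f g n = trans (shift-⊛ (shifts p f) (shifts q g) n) (shift-cong (shifts-⊛ p q f g) n)

cut-shifts : ∀ p i f n → cut (p + i) (shifts p f) n ≡ shifts p (cut i f) n
cut-shifts zero    i f n       = refl
cut-shifts (suc p) i f zero    = refl
cut-shifts (suc p) i f (suc n) = cut-shifts p i f n

cut-shifts-∸ : ∀ i q f n → cut i (shifts q f) n ≡ shifts q (cut (i ∸ q) f) n
cut-shifts-∸ i       zero    f n       = refl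
cut-shifts-∸ zero    (suc q) f n       = refl
cut-shifts-∸ (suc i) (suc q) f zero    = refl
cut-shifts-∸ (suc i) (suc q) f (suc n) = cut-shifts-∸ i q f n

-- f = z ^ (q - p) φ, with both sides moved so that no negative power occurs.
record ShiftOf𝓡 (f : Series) : Set where
  constructor shiftOf𝓡
  field
    p q     : ℕ
    {φ}     : Series
    φ∈      : 𝓡 φ
    shifted : ∀ n → shifts p f n ≡ shifts q φ n

shiftOf𝓡-⊛ : ∀ {f g} → ShiftOf𝓡 f → ShiftOf𝓡 g → ShiftOf𝓡 (f ⊛ g)
shiftOf𝓡-⊛ {f} {g} (shiftOf𝓡 p q {φ} φ∈ f≡) (shiftOf𝓡 p′ q′ {ψ} ψ∈ g≡) =
  shiftOf𝓡 (p + p′) (q + q′) (mul φ∈ ψ∈) λ n → begin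
    shifts (p + p′) (f ⊛ g) n   ≡⟨ shifts-⊛ p p′ f g n ⟨
    (shifts p f ⊛ shifts p′ g) n ≡⟨ ⊛-cong n (λ i _ → f≡ i) (λ i _ → g≡ i) ⟩
    (shifts q φ ⊛ shifts q′ ψ) n ≡⟨ shifts-⊛ q q′ φ ψ n ⟩
    shifts (q + q′) (φ ⊛ ψ) n   ∎

shiftOf𝓡-shift : ∀ {f} → ShiftOf𝓡 f → ShiftOf𝓡 (shift f)
shiftOf𝓡-shift {f} (shiftOf𝓡 p q φ∈ f≡) =
  shiftOf𝓡 p (suc q) φ∈ λ n → trans (shifts-shift p f n) (shift-cong f≡ n)

-- Multiplied by z, the tail of f is f without its constant term, so on the side of φ the terms of z
-- ^ q φ below z ^ (p + 1) are deleted. If q exceeds p there are none, and the truncated subtraction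
-- gives the trivial cut.
shiftOf𝓡-tail : ∀ {f} → ShiftOf𝓡 f → ShiftOf𝓡 (f ∘ suc)
shiftOf𝓡-tail {f} (shiftOf𝓡 p q {φ} φ∈ f≡) = shiftOf𝓡 (suc p) q (trunc (p + 1 ∸ q) φ∈) λ n → begin
  shifts (suc p) (f ∘ suc) n    ≡⟨ shifts-shift p (f ∘ suc) n ⟨
  shifts p (shift (f ∘ suc)) n  ≡⟨ shifts-cong p (λ { zero → refl ; (suc _) → refl }) n ⟩
  shifts p (cut 1 f) n          ≡⟨ cut-shifts p 1 f n ⟨
  cut (p + 1) (shifts p f) n    ≡⟨ cut-cong (p + 1) f≡ n ⟩
  cut (p + 1) (shifts q φ) n    ≡⟨ cut-shifts-∸ (p + 1) q φ n ⟩
  shifts q (cut (p + 1 ∸ q) φ) n ∎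

-- Restricted to nodes: `leaf` enters only through the tail of the Catalan series, which is the
-- generator.
series-shiftOf𝓡 : ∀ B b A → ShiftOf𝓡 (series (node B b A))
tail-shiftOf𝓡 : ∀ t → ShiftOf𝓡 (series t ∘ suc)

series-shiftOf𝓡 leaf             _ A = tail-shiftOf𝓡 A
series-shiftOf𝓡 (node B′ b′ A′) _ A =
  shiftOf𝓡-⊛ (shiftOf𝓡-shift (series-shiftOf𝓡 B′ b′ A′)) (tail-shiftOf𝓡 A)

tail-shiftOf𝓡 leaf         = shiftOf𝓡 0 0 gen λ _ → refl
tail-shiftOf𝓡 (node B b A) = shiftOf𝓡-tail (series-shiftOf𝓡 B b A)

shifts-0 : ∀ p f → shifts p f p ≡ f 0
shifts-0 zero    f = refl
shifts-0 (suc p) f = shifts-0 p f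

shifts-allowed : ∀ q {φ} → 𝓡 φ → ∀ n → Allowed (shifts q φ n)
shifts-allowed zero    φ∈ n       = 𝓡-allowed φ∈ n
shifts-allowed (suc q) φ∈ zero    = λ { _ (() , _) }
shifts-allowed (suc q) φ∈ (suc n) = shifts-allowed q φ∈ n

series-allowed : ∀ t → Allowed (series t 0)
series-allowed leaf         = λ { _ (() , _) }
series-allowed (node B b A) with series-shiftOf𝓡 B b A
... | shiftOf𝓡 p q φ∈ f≡ =
  subst Allowed (trans (sym (f≡ p)) (shifts-0 p (series (node B b A)))) (shifts-allowed q φ∈ p)

fertility-unique : ∀ π {f} → HasFertility π f → f ≡ fertility π
fertility-unique π h = ↔⇒≡ (↔-trans h (↔-sym (hasFertility π)))

infertile : ∀ {f} → f ≤ 126 → Infertile f → InfertilityNumber f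
infertile f≤126 inf (π , h) with refl ← fertility-unique π h =
  series-allowed (tree (reverse (Permutation.word π))) f≤126 inf

-- Words with prescribed fertilities.

Within : ℕ → ℕ → List ℕ → Set
Within lo hi r = Unique r × All (lo <_) r × All (_≤ hi) r

within-[] : ∀ {lo hi} → Within lo hi []
within-[] = [] , [] , []

-- `mid` separates the values of `A` from those of `B`, which gives distinctness across the two
-- parts.
within-node : ∀ {lo mid hi B A} → lo ≤ mid → mid ≤ hi → Within mid hi B → Within lo mid A →
              Within lo (suc hi) (B ++ suc hi ∷ A)
within-node lo≤mid mid≤hi (B! , <B , B≤) (A! , <A , A≤) =
  AllPairs.++⁺ B! (All.map (λ x≤ → <⇒≢ (s≤s (≤-trans x≤ mid≤hi)) ∘ sym) A≤ ∷ A!)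
    (All.map (λ (<x , x≤) → <⇒≢ (s≤s x≤) ∷ All.map (λ y≤ → <⇒≢ (≤-<-trans y≤ <x) ∘ sym) A≤) (All.zip (<B , B≤))) ,
  All.++⁺ (All.map (≤-<-trans lo≤mid) <B) (s≤s (≤-trans lo≤mid mid≤hi) ∷ <A) ,
  All.++⁺ (All.map m≤n⇒m≤1+n B≤) (≤-refl ∷ All.map (λ x≤ → m≤n⇒m≤1+n (≤-trans x≤ mid≤hi)) A≤)

within⇒< : ∀ {lo mid hi r} → mid ≤ hi → Within lo mid r → All (_< suc hi) r
within⇒< mid≤hi (_ , _ , r≤) = All.map (λ x≤ → s≤s (≤-trans x≤ mid≤hi)) r≤

fertile : ∀ {hi} r → Within 0 hi r → FertilityNumber (S r 0)
fertile r (r! , <r , _) = π , subst (HasFertility π) (cong (λ r → S r 0) (reverse-involutive r)) (hasFertility π)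
  where
  π : Permutation
  π = permutation (reverse r) (unique-resp-↭ (↭-sym (↭-reverse r)) r!) (All-resp-↭ (↭-sym (↭-reverse r)) <r)

-- Turns the coefficient of z ^ j into a constant term, hence into a fertility.
topped : ℕ → ℕ → List ℕ → List ℕ
topped N zero    r = r
topped N (suc j) r = suc (N + j) ∷ topped N j r

topped-within : ∀ {lo N} j {r} → lo ≤ N → Within lo N r → Within lo (N + j) (topped N j r)
topped-within {lo} {N} zero    lo≤N r-in = subst (λ h → Within lo h _) (sym (+-identityʳ N)) r-in
topped-within {lo} {N} (suc j) {r} lo≤N r-in = subst (λ h → Within lo h (topped N (suc j) r)) (sym (+-suc N j))
  (within-node (≤-trans lo≤N (m≤m+n N j)) ≤-refl within-[] (topped-within j lo≤N r-in))

S-topped : ∀ {lo N} j {r} → lo ≤ N → Within lo N r → ∀ n → S (topped N j r) n ≡ S r (j + n)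
S-topped zero    _    _    n = refl
S-topped {N = N} (suc j) {r} lo≤N r-in n = begin
  S (suc (N + j) ∷ topped N j r) n ≡⟨ cong (λ f → f n) (S-top (within⇒< ≤-refl (topped-within j lo≤N r-in))) ⟩
  S (topped N j r) (suc n)         ≡⟨ S-topped j lo≤N r-in (suc n) ⟩
  S r (j + suc n)                  ≡⟨ cong (S r) (+-suc j n) ⟩
  S r (suc j + n)                  ∎

ascending : ℕ → ℕ → List ℕ
ascending N zero    = []
ascending N (suc k) = ascending N k ++ suc (N + k) ∷ []

ascending-within : ∀ N k → Within N (N + k) (ascending N k)
ascending-within N zero    = within-[]
ascending-within N (suc k) = subst (λ h → Within N h (ascending N (suc k))) (sym (+-suc N k))
  (within-node ≤-refl (m≤m+n N k) (ascending-within N k) within-[])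

-- catalanPower k is the (k + 1)-st power of catalan ∘ suc.
catalanPower : ℕ → Series
catalanPower zero    = catalan ∘ suc
catalanPower (suc k) = catalanPower k ⊛ (catalan ∘ suc)

catalanPower-0 : ∀ k → catalanPower k 0 ≡ 1
catalanPower-0 zero    = refl
catalanPower-0 (suc k) = cong (_* 1) (catalanPower-0 k)

catalanPower-1 : ∀ k → catalanPower k 1 ≡ 2 * suc k
catalanPower-1 zero    = refl
catalanPower-1 (suc k) = trans (cong₂ (λ a b → a * 2 + b * 1) (catalanPower-0 k) (catalanPower-1 k))
  (solve 1 (λ k → con 1 :* con 2 :+ con 2 :* (con 1 :+ k) :* con 1 := con 2 :* (con 2 :+ k)) refl k)

-- With c = 1 + 2 z + 5 z ^ 2 + ... and K = k + 1, the coefficient is 5 K + 4 K (K - 1) / 2.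
catalanPower-2 : ∀ k → catalanPower k 2 ≡ suc k * (2 * suc k + 3)
catalanPower-2 zero    = refl
catalanPower-2 (suc k) = trans
  (cong₂ _+_ (cong (_* 5) (catalanPower-0 k)) (cong₂ (λ a b → a * 2 + b * 1) (catalanPower-1 k) (catalanPower-2 k)))
  (solve 1 (λ k → con 1 :* con 5 :+ (con 2 :* (con 1 :+ k) :* con 2 :+ (con 1 :+ k) :* (con 2 :* (con 1 :+ k) :+ con 3) :* con 1)
              := (con 2 :+ k) :* (con 2 :* (con 2 :+ k) :+ con 3)) refl k)

S-nonempty-node : ∀ {B b A} → B ≢ [] → All (_< b) B → All (_< b) A →
                  S (B ++ b ∷ A) ≡ shift (S B) ⊛ (S A ∘ suc)
S-nonempty-node {[]}    B≢[] _  _  = ⊥-elim (B≢[] refl)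
S-nonempty-node {_ ∷ _} _    B< A< = S-node B< A<

ascending-nonempty : ∀ N k → ascending N (suc k) ≢ []
ascending-nonempty N k eq with ascending N k
ascending-nonempty N k () | []
ascending-nonempty N k () | _ ∷ _

-- The tree is a left path with empty right subtrees; each node after the first contributes a factor
-- z c.
S-ascending : ∀ N k n → S (ascending N (suc k)) n ≡ shifts k (catalanPower k) n
S-ascending N zero    n = refl
S-ascending N (suc k) n = begin
  S (ascending N (suc k) ++ suc (N + suc k) ∷ []) n
    ≡⟨ cong (λ f → f n) (S-nonempty-node (ascending-nonempty N k) (within⇒< ≤-refl (ascending-within N (suc k))) []) ⟩
  (shift (S (ascending N (suc k))) ⊛ (catalan ∘ suc)) n
    ≡⟨ shift-⊛ (S (ascending N (suc k))) (catalan ∘ suc) n ⟩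
  shift (S (ascending N (suc k)) ⊛ (catalan ∘ suc)) n
    ≡⟨ shift-cong (λ i → ⊛-cong i (λ j _ → S-ascending N k j) (λ _ _ → refl)) n ⟩
  shift (shifts k (catalanPower k) ⊛ (catalan ∘ suc)) n
    ≡⟨ shift-cong (shifts-⊛ k 0 (catalanPower k) (catalan ∘ suc)) n ⟩
  shift (shifts (k + 0) (catalanPower (suc k))) n
    ≡⟨ cong (λ k′ → shifts (suc k′) (catalanPower (suc k)) n) (+-identityʳ k) ⟩
  shifts (suc k) (catalanPower (suc k)) n ∎

shifts-+ : ∀ p f n → shifts p f (p + n) ≡ f n
shifts-+ zero    f n = refl
shifts-+ (suc p) f n = shifts-+ p f n

-- The first `k` added letters cancel z ^ k, so that `j` indexes the coefficients of the power of c
-- itself.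
base : ℕ → ℕ → List ℕ
base k j = topped (suc k) (k + j) (ascending 0 (suc k))

base-within : ∀ k j → Within 0 (suc k + (k + j)) (base k j)
base-within k j = topped-within (k + j) z≤n (ascending-within 0 (suc k))

S-base : ∀ k j n → S (base k j) n ≡ catalanPower k (j + n)
S-base k j n = begin
  S (base k j) n                              ≡⟨ S-topped (k + j) z≤n (ascending-within 0 (suc k)) n ⟩
  S (ascending 0 (suc k)) (k + j + n)         ≡⟨ S-ascending 0 k (k + j + n) ⟩
  shifts k (catalanPower k) (k + j + n)       ≡⟨ cong (shifts k (catalanPower k)) (+-assoc k j n) ⟩
  shifts k (catalanPower k) (k + (j + n))     ≡⟨ shifts-+ k (catalanPower k) (j + n) ⟩
  catalanPower k (j + n)                      ∎

fertile-even : ∀ k → FertilityNumber (2 * suc k)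
fertile-even k = subst FertilityNumber (trans (S-base k 1 0) (catalanPower-1 k))
  (fertile (base k 1) (base-within k 1))

fertile-pow₂ : ∀ k → FertilityNumber (suc k * (2 * suc k + 3))
fertile-pow₂ k = subst FertilityNumber (trans (S-base k 2 0) (catalanPower-2 k))
  (fertile (base k 2) (base-within k 2))

-- With K = k + 1 this is the coefficient of z ^ 2 in (c ^ K - 1) c ^ m, namely K (2 K + 3) + 2 K *
-- 2 m. For m = 0 the power c ^ K alone gives it.
fertile-family : ∀ k m → FertilityNumber (suc k * (2 * suc k + 3) + 4 * suc k * m)
fertile-family k zero = subst FertilityNumber
  (solve 1 (λ k → (con 1 :+ k) :* (con 2 :* (con 1 :+ k) :+ con 3)
     := (con 1 :+ k) :* (con 2 :* (con 1 :+ k) :+ con 3) :+ con 4 :* (con 1 :+ k) :* con 0) refl k)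
  (fertile-pow₂ k)
fertile-family k (suc m) = subst FertilityNumber S≡
  -- Here `suc m` letters cancel the power of z contributed by `B` and its parent node, and one more
  -- selects the coefficient of z.
  (fertile (topped (suc hi) (suc m + 1) r) (topped-within (suc m + 1) z≤n r-in))
  where
  N hi : ℕ
  N  = suc k + (k + 0)
  hi = N + suc m
  A B r : List ℕ
  A = base k 0
  B = ascending N (suc m)
  -- The series of `A` is c ^ K, from which this node removes the constant term; that of `B`
  -- supplies the other power of c.
  r = B ++ suc hi ∷ A
  r-in : Within 0 (suc hi) r
  r-in = within-node z≤n (m≤m+n N (suc m)) (ascending-within N (suc m)) (base-within k 0)
  S-r : ∀ n → S r (suc m + n) ≡ (catalanPower m ⊛ (catalanPower k ∘ suc)) n
  S-r n = begin
    S r (suc m + n)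
      ≡⟨ cong (λ f → f (suc m + n)) (S-nonempty-node (ascending-nonempty N m)
           (within⇒< ≤-refl (ascending-within N (suc m))) (within⇒< (m≤m+n N (suc m)) (base-within k 0))) ⟩
    (shift (S B) ⊛ (S A ∘ suc)) (suc m + n)
      ≡⟨ ⊛-cong (suc m + n) (λ i _ → shift-cong (S-ascending N m) i) (λ i _ → S-base k 0 (suc i)) ⟩
    (shifts (suc m) (catalanPower m) ⊛ (catalanPower k ∘ suc)) (suc m + n)
      ≡⟨ shifts-⊛ (suc m) 0 (catalanPower m) (catalanPower k ∘ suc) (suc m + n) ⟩
    shifts (suc m + 0) (catalanPower m ⊛ (catalanPower k ∘ suc)) (suc m + n)
      ≡⟨ cong (λ p → shifts p (catalanPower m ⊛ (catalanPower k ∘ suc)) (suc m + n)) (+-identityʳ (suc m)) ⟩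
    shifts (suc m) (catalanPower m ⊛ (catalanPower k ∘ suc)) (suc m + n)
      ≡⟨ shifts-+ (suc m) (catalanPower m ⊛ (catalanPower k ∘ suc)) n ⟩
    (catalanPower m ⊛ (catalanPower k ∘ suc)) n ∎
  S≡ : S (topped (suc hi) (suc m + 1) r) 0 ≡ suc k * (2 * suc k + 3) + 4 * suc k * suc m
  S≡ = begin
    S (topped (suc hi) (suc m + 1) r) 0 ≡⟨ S-topped (suc m + 1) z≤n r-in 0 ⟩
    S r (suc m + 1 + 0)                 ≡⟨ cong (S r) (+-identityʳ (suc m + 1)) ⟩
    S r (suc m + 1)                     ≡⟨ S-r 1 ⟩
    catalanPower m 0 * catalanPower k 2 + catalanPower m 1 * catalanPower k 1
      ≡⟨ cong₂ _+_ (cong₂ _*_ (catalanPower-0 m) (catalanPower-2 k)) (cong₂ _*_ (catalanPower-1 m) (catalanPower-1 k)) ⟩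
    1 * (suc k * (2 * suc k + 3)) + 2 * suc m * (2 * suc k)
      ≡⟨ solve 2 (λ k m → con 1 :* ((con 1 :+ k) :* (con 2 :* (con 1 :+ k) :+ con 3)) :+
           con 2 :* (con 1 :+ m) :* (con 2 :* (con 1 :+ k))
           := (con 1 :+ k) :* (con 2 :* (con 1 :+ k) :+ con 3) :+ con 4 :* (con 1 :+ k) :* (con 1 :+ m)) refl k m ⟩
    suc k * (2 * suc k + 3) + 4 * suc k * suc m ∎

fertile-1 : FertilityNumber 1
fertile-1 = fertile {0} [] within-[]

fertile-0 : FertilityNumber 0
fertile-0 = fertile (ascending 0 2) (ascending-within 0 2)

-- The word 1243567.
fertile-95 : FertilityNumber 95
fertile-95 = fertile (topped 4 3 (ascending 2 1 ++ 4 ∷ topped 0 2 []))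
  (topped-within 3 z≤n (within-node {mid = 2} z≤n (n≤1+n 2) (ascending-within 2 1) (topped-within 2 z≤n within-[])))

-- Parameters are computed from `f`, so each clause is a decidable equation. The even clause fails
-- at 0, which is listed apart. The last three clauses are the family with K = 1, 3 and 7.
Listed : ℕ → Set
Listed f = f ≡ 0 ⊎ f ≡ 1 ⊎ f ≡ 95 ⊎ f ≡ 2 * suc (pred (f / 2)) ⊎
           f ≡ 5 + 4 * ((f ∸ 5) / 4) ⊎ f ≡ 27 + 12 * ((f ∸ 27) / 12) ⊎ f ≡ 119 + 28 * 0

listed⇒fertile : ∀ f → Listed f → FertilityNumber f
listed⇒fertile f (inj₁ refl)        = fertile-0
listed⇒fertile f (inj₂ (inj₁ refl)) = fertile-1
listed⇒fertile f (inj₂ (inj₂ (inj₁ refl))) = fertile-95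
listed⇒fertile f (inj₂ (inj₂ (inj₂ (inj₁ f≡)))) =
  subst FertilityNumber (sym f≡) (fertile-even (pred (f / 2)))
listed⇒fertile f (inj₂ (inj₂ (inj₂ (inj₂ (inj₁ f≡))))) =
  subst FertilityNumber (sym f≡) (fertile-family 0 ((f ∸ 5) / 4))
listed⇒fertile f (inj₂ (inj₂ (inj₂ (inj₂ (inj₂ (inj₁ f≡)))))) =
  subst FertilityNumber (sym f≡) (fertile-family 2 ((f ∸ 27) / 12))
listed⇒fertile f (inj₂ (inj₂ (inj₂ (inj₂ (inj₂ (inj₂ f≡)))))) =
  subst FertilityNumber (sym f≡) (fertile-family 6 0)

-- Classification of the numbers up to 126.

infertile⊎listed? : ∀ f → Dec (Infertile f ⊎ Listed f)
infertile⊎listed? f = infertile? f ⊎-dec f ≟ 0 ⊎-dec f ≟ 1 ⊎-dec f ≟ 95 ⊎-dec f ≟ _ ⊎-dec f ≟ _ ⊎-dec f ≟ _ ⊎-dec f ≟ _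

infertile⊎listed : ∀ {f} → f < 127 → Infertile f ⊎ Listed f
infertile⊎listed = toWitness {a? = allUpTo? infertile⊎listed? 127} tt

theorem5p3 : (f : ℕ) → f ≤ 126 →
    InfertilityNumber f ⇔ (f % 4 ≡ 3 × (f ≢ 95 × f ≢ 119) × (f < 27 ⊎ f % 12 ≢ 3))
theorem5p3 f f≤126 = mk⇔ (λ inf → [ id , ⊥-elim ∘ inf ∘ listed⇒fertile f ]′ (infertile⊎listed (s≤s f≤126)))
  (infertile f≤126)
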